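{- Let $q$ be a prime power, let $0\leqslant j\leqslant q-2$ and let $n\geqslant 1$ be an integer with $n\leqslant j+1$. Then the matrix $M(j,n,q)$ is antidiagonal, i.e. its entry $m_{a,b}$ is $0$ whenever $a+b\neq n+1$.
   Context: Let $q$ be a power of a prime $p$. For integers $0\leqslant j\leqslant q-2$ and $n\geqslant 1$, $M(j,n,q)=(m_{a,b})_{1\leqslant a,b\leqslant n}$ is the $n\times n$ matrix over $\mathbb{F}_p$ with entries (binomial coefficients reduced modulo $p$, with $\binom{x}{y}=0$ for integers $0\leqslant x<y$) $$m_{a,b}=-\left[\binom{j+(n-a)(q-1)}{j+(n-b)(q-1)}+(-1)^{j+1}\binom{j+(n-a)(q-1)}{j+(b-1)(q-1)}\right]\ \text{ if } a\neq b,\qquad m_{a,a}=(-1)^{j+2}\binom{j+(n-a)(q-1)}{j+(a-1)(q-1)}.$$ (It is the matrix of coefficients, with the powers of $t$ removed, of the Atkin operator $U_t$ acting on a block of $\Gamma_0(t)$-invariant Drinfeld cusp forms of weight $k=2j+2+(n-1)(q-1)$.) -}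

module Defs where

open import Algebra.Bundles using (CommutativeRing)
import Algebra.Properties.Semiring.Exp as Exp
open import Data.Fin.Base using (Fin; toℕ)
open import Data.Fin.Properties using (_≟_)
open import Data.Integer.Base as ℤ using (ℤ; +_; 0ℤ; 1ℤ)
open import Data.Integer.Divisibility.Signed using (_∣_; divides; ∣m⇒∣-m; ∣m∣n⇒∣m+n; ∣n⇒∣m*n)
import Data.Integer.Properties as ℤₚ
import Data.Integer.Tactic.RingSolver as ℤSolver
open import Data.Nat.Base using (ℕ; suc; _+_; _∸_; _*_)
open import Data.Nat.Combinatorics using (_C_)
open import Data.Product.Base using (_,_)
open import Data.Vec.Functional using (Vector)
open import Level using (0ℓ)
open import Relation.Binary.PropositionalEquality
  using (_≡_; _≢_; refl; subst)
open import Relation.Nullary.Decidable.Core using (yes; no)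

-- A record rather than a plain synonym for divisibility, so that x and y can
-- be inferred from a proof of congruence.
record Congruent (p : ℕ) (x y : ℤ) : Set where
  constructor congruent
  field difference : + p ∣ (x ℤ.- y)

open Congruent public

-- The ring ℤ/p as a setoid: integers up to congruence modulo p.  For p prime
-- this is the field 𝔽_p; reduction modulo p is the identity on carriers.
module _ (p : ℕ) where

  private
    ≡⇒≈ : ∀ {x y} → x ≡ y → Congruent p x y
    ≡⇒≈ {x} refl = congruent (divides 0ℤ (ℤₚ.+-inverseʳ x))

    ≈-sym : ∀ {x y} → Congruent p x y → Congruent p y x
    ≈-sym {x} {y} (congruent d) = congruent (subst (+ p ∣_) (lemma x y) (∣m⇒∣-m d))
      where
      lemma : ∀ x y → ℤ.- (x ℤ.- y) ≡ y ℤ.- x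
      lemma = ℤSolver.solve-∀

    ≈-trans : ∀ {x y z} → Congruent p x y → Congruent p y z → Congruent p x z
    ≈-trans {x} {y} {z} (congruent d) (congruent e) =
      congruent (subst (+ p ∣_) (lemma x y z) (∣m∣n⇒∣m+n d e))
      where
      lemma : ∀ x y z → (x ℤ.- y) ℤ.+ (y ℤ.- z) ≡ x ℤ.- z
      lemma = ℤSolver.solve-∀

    +-cong : ∀ {x y u v} → Congruent p x y → Congruent p u v →
             Congruent p (x ℤ.+ u) (y ℤ.+ v)
    +-cong {x} {y} {u} {v} (congruent d) (congruent e) =
      congruent (subst (+ p ∣_) (lemma x y u v) (∣m∣n⇒∣m+n d e))
      where
      lemma : ∀ x y u v → (x ℤ.- y) ℤ.+ (u ℤ.- v) ≡ (x ℤ.+ u) ℤ.- (y ℤ.+ v)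
      lemma = ℤSolver.solve-∀

    *-cong : ∀ {x y u v} → Congruent p x y → Congruent p u v →
             Congruent p (x ℤ.* u) (y ℤ.* v)
    *-cong {x} {y} {u} {v} (congruent d) (congruent e) =
      congruent (subst (+ p ∣_) (lemma x y u v) (∣m∣n⇒∣m+n (∣n⇒∣m*n u d) (∣n⇒∣m*n y e)))
      where
      lemma : ∀ x y u v → u ℤ.* (x ℤ.- y) ℤ.+ y ℤ.* (u ℤ.- v) ≡ x ℤ.* u ℤ.- y ℤ.* v
      lemma = ℤSolver.solve-∀

    neg-cong : ∀ {x y} → Congruent p x y → Congruent p (ℤ.- x) (ℤ.- y)
    neg-cong {x} {y} (congruent d) = congruent (subst (+ p ∣_) (lemma x y) (∣m⇒∣-m d))
      where
      lemma : ∀ x y → ℤ.- (x ℤ.- y) ≡ (ℤ.- x) ℤ.- (ℤ.- y)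
      lemma = ℤSolver.solve-∀

  𝔽 : CommutativeRing 0ℓ 0ℓ
  𝔽 = record
    { Carrier = ℤ
    ; _≈_     = Congruent p
    ; _+_     = ℤ._+_
    ; _*_     = ℤ._*_
    ; -_      = ℤ.-_
    ; 0#      = 0ℤ
    ; 1#      = 1ℤ
    ; isCommutativeRing = record
      { isRing = record
        { +-isAbelianGroup = record
          { isGroup = record
            { isMonoid = record
              { isSemigroup = record
                { isMagma = record
                  { isEquivalence = record { refl = ≡⇒≈ refl ; sym = ≈-sym ; trans = ≈-trans }
                  ; ∙-cong        = +-cong
                  }
                ; assoc = λ x y z → ≡⇒≈ (ℤₚ.+-assoc x y z)
                }
              ; identity = (λ x → ≡⇒≈ (ℤₚ.+-identityˡ x)) , (λ x → ≡⇒≈ (ℤₚ.+-identityʳ x))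
              }
            ; inverse = (λ x → ≡⇒≈ (ℤₚ.+-inverseˡ x)) , (λ x → ≡⇒≈ (ℤₚ.+-inverseʳ x))
            ; ⁻¹-cong = neg-cong
            }
          ; comm = λ x y → ≡⇒≈ (ℤₚ.+-comm x y)
          }
        ; *-cong     = *-cong
        ; *-assoc    = λ x y z → ≡⇒≈ (ℤₚ.*-assoc x y z)
        ; *-identity = (λ x → ≡⇒≈ (ℤₚ.*-identityˡ x)) , (λ x → ≡⇒≈ (ℤₚ.*-identityʳ x))
        ; distrib    = (λ x y z → ≡⇒≈ (ℤₚ.*-distribˡ-+ x y z))
                     , (λ x y z → ≡⇒≈ (ℤₚ.*-distribʳ-+ x y z))
        }
      ; *-comm = λ x y → ≡⇒≈ (ℤₚ.*-comm x y)
      }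
    }

  binom : ℕ → ℕ → CommutativeRing.Carrier 𝔽
  binom x y = + (x C y)

SquareMatrix : Set → ℕ → Set
SquareMatrix A n = Vector (Vector A n) n

-- Rows and columns are numbered 1, …, n in the mathematics.
index : ∀ {n} → Fin n → ℕ
index a = suc (toℕ a)

IsAntidiagonal : (R : CommutativeRing 0ℓ 0ℓ) → ∀ {n} →
                 SquareMatrix (CommutativeRing.Carrier R) n → Set
IsAntidiagonal R {n} A = ∀ a b → index a + index b ≢ n + 1 → A a b ≈ 0#
  where open CommutativeRing R using (_≈_; 0#)

-- The subtractions n ∸ index a, index b ∸ 1 and q ∸ 1 are never truncated
-- when q ≥ 1, since 1 ≤ index a, index b ≤ n.  The library's x C y is 0 for
-- x < y.
module _ (p : ℕ) (j n q : ℕ) where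

  open CommutativeRing (𝔽 p) using (Carrier; semiring; 1#; -_)
    renaming (_+_ to _⊕_; _*_ to _⊛_)
  open Exp semiring using (_^_)

  down up : Fin n → ℕ
  down a = j + (n ∸ index a) * (q ∸ 1)
  up   a = j + (index a ∸ 1) * (q ∸ 1)

  M : SquareMatrix Carrier n
  M a b with a ≟ b
  ... | no  _ = - (binom p (down a) (down b) ⊕ (- 1#) ^ (j + 1) ⊛ binom p (down a) (up b))
  ... | yes _ = (- 1#) ^ (j + 2) ⊛ binom p (down a) (up a)

{-# OPTIONS --safe #-}
-- Since j + A (q - 1) = A q + (j - A), and 0 ≤ j - A < q for A < n, all the
-- binomials in M have the form C (A q + (j - A), B q + (j - B)).  If A < B this
-- vanishes because the lower index exceeds the upper one; if B < A the residues
-- satisfy j - A < j - B < q, and p divides it, a case of Lucas' congruence.  So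
-- only the terms with A = B survive; for a ≠ b that means n - a = b - 1.
module Submission where

open import Defs
open import Algebra.Bundles using (CommutativeRing)
import Algebra.Properties.Ring as RingProperties
import Algebra.Properties.Semiring.Exp as Exp
open import Data.Fin.Base using (Fin; toℕ)
open import Data.Fin.Properties using (_≟_; toℕ<n; toℕ-injective)
open import Data.Integer.Base as ℤ using (0ℤ)
import Data.Integer.Divisibility.Signed as ℤ∣
import Data.Integer.Properties as ℤₚ
open import Data.Nat.Base
  using (ℕ; zero; suc; _∸_; _^_; _≤_; _<_; _+_; _*_; s≤s; s≤s⁻¹; s<s⁻¹; z<s; NonZero)
open import Data.Nat.Combinatorics using (_C_; k>n⇒nCk≡0; nC1≡n; nCk+nC[k+1]≡[n+1]C[k+1])
open import Data.Nat.Divisibility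
  using (_∣_; divides-refl; ∣-trans; 1∣_; _∣0; m∣m*n; n∣m*n; ∣m⇒∣m*n; ∣m∣n⇒∣m+n; ∣m+n∣m⇒∣n;
         *-cancelˡ-∣; *-monoʳ-∣; >⇒∤)
open import Data.Nat.Primality using (Prime; euclidsLemma; prime⇒nonZero)
open import Data.Nat.Properties
  using (+-assoc; +-comm; +-monoˡ-<; +-suc; *-comm; *-distribˡ-+; *-identityʳ;
         *-identityˡ; *-monoˡ-≤; *-suc; *-zeroʳ; <-cmp; <-trans; m+[n∸m]≡n; m^n≢0; m∸n+n≡m;
         m∸n≤m; m≤n+m; n<1+n; suc-injective; ∸-cancelˡ-≡; ∸-monoʳ-<; ∸-monoˡ-≤; ≤-<-trans;
         ≤-trans; module ≤-Reasoning)
open import Data.Nat.Tactic.RingSolver using (solve-∀)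
open import Data.Sum.Base using (_⊎_; inj₁; inj₂)
open import Function.Base using (_∘_)
open import Relation.Binary.Definitions using (tri<; tri≈; tri>)
open import Relation.Binary.PropositionalEquality
  using (_≡_; _≢_; refl; sym; trans; cong; cong₂; subst; module ≡-Reasoning)
open import Relation.Nullary.Decidable.Core using (yes; no)
open import Relation.Nullary.Negation using (contradiction)

-- Absorption identity, by induction along Pascal's rule. It moves a divisor of the upper index onto
-- a multiple of the binomial.
[k+1]*[n+1]C[k+1]≡[n+1]*nCk : ∀ n k → suc k * (suc n C suc k) ≡ suc n * (n C k)
[k+1]*[n+1]C[k+1]≡[n+1]*nCk n zero =
  trans (*-identityˡ (suc n C 1)) (trans (nC1≡n (suc n)) (sym (*-identityʳ (suc n))))
[k+1]*[n+1]C[k+1]≡[n+1]*nCk zero (suc k) = begin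
  suc (suc k) * (1 C suc (suc k)) ≡⟨ cong (suc (suc k) *_) (k>n⇒nCk≡0 {1} {suc (suc k)} (s≤s z<s)) ⟩
  suc (suc k) * 0                 ≡⟨ *-zeroʳ (suc (suc k)) ⟩
  1 * 0                           ≡⟨ cong (1 *_) (k>n⇒nCk≡0 {0} {suc k} z<s) ⟨
  1 * (0 C suc k)                 ∎
  where open ≡-Reasoning
[k+1]*[n+1]C[k+1]≡[n+1]*nCk (suc n) (suc k) = begin
  suc (suc k) * (suc (suc n) C suc (suc k))
    ≡⟨ cong (suc (suc k) *_) (nCk+nC[k+1]≡[n+1]C[k+1] (suc n) (suc k)) ⟨
  suc (suc k) * (c + (suc n C suc (suc k)))
    -- One copy of `c` is set aside: the `suc k` copies left match the induction hypothesis at `k`,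
    -- the other summand the one at `suc k`.
    ≡⟨ split (suc k) c (suc n C suc (suc k)) ⟩
  c + (suc k * c + suc (suc k) * (suc n C suc (suc k)))
    ≡⟨ cong (c +_) (cong₂ _+_ ([k+1]*[n+1]C[k+1]≡[n+1]*nCk n k)
                              ([k+1]*[n+1]C[k+1]≡[n+1]*nCk n (suc k))) ⟩
  c + (suc n * (n C k) + suc n * (n C suc k))
    ≡⟨ cong (c +_) (*-distribˡ-+ (suc n) (n C k) (n C suc k)) ⟨
  c + suc n * (n C k + n C suc k)
    ≡⟨ cong (λ z → c + suc n * z) (nCk+nC[k+1]≡[n+1]C[k+1] n k) ⟩
  suc (suc n) * c ∎
  where
  open ≡-Reasoning
  c : ℕ
  c = suc n C suc k
  split : ∀ l x y → suc l * (x + y) ≡ x + (l * x + suc l * y)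
  split = solve-∀

-- Unless p divides n, Euclid's lemma finds each factor p in m, where it is cancelled before the
-- next one is sought.
p^r∣m*n⇒p^r∣m⊎p∣n : ∀ {p} → Prime p → ∀ r m n → p ^ r ∣ m * n → p ^ r ∣ m ⊎ p ∣ n
p^r∣m*n⇒p^r∣m⊎p∣n pr zero m n _ = inj₁ (1∣ m)
p^r∣m*n⇒p^r∣m⊎p∣n {p} pr (suc r) m n pʳ⁺¹∣mn
  with euclidsLemma m n pr (∣-trans (m∣m*n (p ^ r)) pʳ⁺¹∣mn)
... | inj₂ p∣n = inj₂ p∣n
... | inj₁ (divides-refl m′)
  with p^r∣m*n⇒p^r∣m⊎p∣n pr r m′ n
         (*-cancelˡ-∣ p (subst (p * p ^ r ∣_) (pull m′ p n) pʳ⁺¹∣mn))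
  where
  instance _ = prime⇒nonZero pr
  pull : ∀ x y z → x * y * z ≡ y * (x * z)
  pull = solve-∀
...   | inj₂ p∣n   = inj₂ p∣n
...   | inj₁ pʳ∣m′ = inj₁ (subst (p * p ^ r ∣_) (*-comm p m′) (*-monoʳ-∣ p pʳ∣m′))

-- For s = 0, absorption gives q ∣ A q C = (t + B q) C′ with C′ the binomial,
-- while q ∤ t + B q; Pascal's rule then raises s.
p∣[s+A*q]C[t+B*q] : ∀ {p} r → Prime p → ∀ s t A B → s < t → t < p ^ r →
                    p ∣ (s + A * p ^ r) C (t + B * p ^ r)
p∣[s+A*q]C[t+B*q] {p} r pr zero (suc t) A B s<t t<q
  with p^r∣m*n⇒p^r∣m⊎p∣n pr r (suc t + B * q) ((A * q) C (suc t + B * q))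
         (absorb (A * q) (t + B * q) (n∣m*n A))
  where
  q = p ^ r
  absorb : ∀ x k → q ∣ x → q ∣ suc k * (x C suc k)
  -- Absorption needs a predecessor of the upper index; at 0 the binomial itself is 0.
  absorb zero    k _   = subst (q ∣_)
    (sym (trans (cong (suc k *_) (k>n⇒nCk≡0 {0} {suc k} z<s)) (*-zeroʳ (suc k)))) (q ∣0)
  absorb (suc x) k q∣x = subst (q ∣_) (sym ([k+1]*[n+1]C[k+1]≡[n+1]*nCk x k))
    (∣m⇒∣m*n (x C k) q∣x)
... | inj₂ p∣C = p∣C
-- Removing the multiple B q, q would divide the residue `suc t`, which is positive and less than q.
... | inj₁ q∣y = contradiction
  (∣m+n∣m⇒∣n (subst (p ^ r ∣_) (+-comm (suc t) (B * p ^ r)) q∣y) (n∣m*n B))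
  (>⇒∤ t<q)
p∣[s+A*q]C[t+B*q] {p} r pr (suc s) (suc t) A B s<t t<q =
  subst (p ∣_) (nCk+nC[k+1]≡[n+1]C[k+1] (s + A * p ^ r) (t + B * p ^ r))
    (∣m∣n⇒∣m+n
      -- Both Pascal summands have upper residue s, still below the lower residues t and t + 1.
      (p∣[s+A*q]C[t+B*q] r pr s t A B (s<s⁻¹ s<t) (<-trans (n<1+n t) t<q))
      (p∣[s+A*q]C[t+B*q] r pr s (suc t) A B (<-trans (n<1+n s) s<t) t<q))

j+A*[q∸1]≡[j∸A]+A*q : ∀ {j A} q .{{_ : NonZero q}} → A ≤ j →
                      j + A * (q ∸ 1) ≡ (j ∸ A) + A * q
j+A*[q∸1]≡[j∸A]+A*q {j} {A} (suc q) A≤j = begin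
  j + A * q             ≡⟨ cong (_+ A * q) (m∸n+n≡m A≤j) ⟨
  j ∸ A + A + A * q     ≡⟨ +-assoc (j ∸ A) A (A * q) ⟩
  j ∸ A + (A + A * q)   ≡⟨ cong (j ∸ A +_) (*-suc A q) ⟨
  j ∸ A + A * suc q     ∎
  where open ≡-Reasoning

A≢B⇒p∣[j+A*[q∸1]]C[j+B*[q∸1]] : ∀ {p} r → Prime p → ∀ {j A B} → j < p ^ r →
  A ≤ j → B ≤ j → A ≢ B → p ∣ (j + A * (p ^ r ∸ 1)) C (j + B * (p ^ r ∸ 1))
A≢B⇒p∣[j+A*[q∸1]]C[j+B*[q∸1]] {p} r pr {j} {A} {B} j<q A≤j B≤j A≢B
  rewrite j+A*[q∸1]≡[j∸A]+A*q (p ^ r) {{m^n≢0 p r {{prime⇒nonZero pr}}}} A≤j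
        | j+A*[q∸1]≡[j∸A]+A*q (p ^ r) {{m^n≢0 p r {{prime⇒nonZero pr}}}} B≤j
  with <-cmp A B
... | tri< A<B _ _ = subst (p ∣_) (sym (k>n⇒nCk≡0 x<y)) (p ∣0)
  where
  open ≤-Reasoning
  x<y : (j ∸ A) + A * p ^ r < (j ∸ B) + B * p ^ r
  x<y = begin-strict
    -- The remainder j - A is less than q, so the quotients alone decide the order.
    (j ∸ A) + A * p ^ r <⟨ +-monoˡ-< (A * p ^ r) (≤-<-trans (m∸n≤m j A) j<q) ⟩
    suc A * p ^ r       ≤⟨ *-monoˡ-≤ (p ^ r) A<B ⟩
    B * p ^ r           ≤⟨ m≤n+m (B * p ^ r) (j ∸ B) ⟩
    (j ∸ B) + B * p ^ r ∎
... | tri≈ _ A≡B _ = contradiction A≡B A≢B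
... | tri> _ _ B<A = p∣[s+A*q]C[t+B*q] r pr (j ∸ A) (j ∸ B) A B
  (∸-monoʳ-< B<A A≤j) (≤-<-trans (m∸n≤m j B) j<q)

p∣m⇒+m≈0 : ∀ {p m} → p ∣ m → Congruent p (ℤ.+ m) 0ℤ
p∣m⇒+m≈0 {p} {m} p∣m =
  congruent (subst (ℤ.+ p ℤ∣.∣_) (sym (ℤₚ.+-identityʳ (ℤ.+ m))) (ℤ∣.∣ᵤ⇒∣ p∣m))

module _ {c ℓ} (R : CommutativeRing c ℓ) where
  open CommutativeRing R
    using (_≈_; 0#; -_; ring; +-cong; -‿cong; *-congˡ; zeroʳ; +-identityˡ)
    renaming (_+_ to _⊕_; _*_ to _⊛_; trans to ≈-trans)

  y≈0⇒x*y≈0 : ∀ x {y} → y ≈ 0# → x ⊛ y ≈ 0#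
  y≈0⇒x*y≈0 x y≈0 = ≈-trans (*-congˡ y≈0) (zeroʳ x)

  x≈0∧y≈0⇒-[x+y]≈0 : ∀ {x y} → x ≈ 0# → y ≈ 0# → - (x ⊕ y) ≈ 0#
  x≈0∧y≈0⇒-[x+y]≈0 x≈0 y≈0 =
    ≈-trans (-‿cong (≈-trans (+-cong x≈0 y≈0) (+-identityˡ 0#))) (RingProperties.-0#≈0# ring)

-- Used in contrapositive form, with a and b counted from 0: off the antidiagonal, the multipliers
-- of q - 1 in `down a` and `up b` differ.
n∸[1+a]≡b⇒[1+a]+[1+b]≡n+1 : ∀ {n a b} → a < n → n ∸ suc a ≡ b → suc a + suc b ≡ n + 1
n∸[1+a]≡b⇒[1+a]+[1+b]≡n+1 {n} {a} a<n refl = begin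
  suc a + suc (n ∸ suc a)   ≡⟨ +-suc (suc a) (n ∸ suc a) ⟩
  suc (suc a + (n ∸ suc a)) ≡⟨ cong suc (m+[n∸m]≡n a<n) ⟩
  suc n                     ≡⟨ +-comm 1 n ⟩
  n + 1                     ∎
  where open ≡-Reasoning

theorem5p2 : (p r q : ℕ) → Prime p → 1 ≤ r → q ≡ p ^ r →
    (j n : ℕ) → j ≤ q ∸ 2 → 1 ≤ n → n ≤ j + 1 →
    IsAntidiagonal (𝔽 p) (M p j n q)
theorem5p2 p r q pr _ refl j n j≤q∸2 _ n≤j+1 a b a+b≢n+1 = antidiagonal
  where
  j≤q∸2⇒j<q : ∀ q .{{_ : NonZero q}} → j ≤ q ∸ 2 → j < q
  -- At q = 1 the subtraction truncates to 0, and j < 1 still follows.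
  j≤q∸2⇒j<q (suc q) j≤ = s≤s (≤-trans j≤ (m∸n≤m q 1))

  vanish : ∀ {A B} → A ≤ j → B ≤ j → A ≢ B →
           p ∣ (j + A * (p ^ r ∸ 1)) C (j + B * (p ^ r ∸ 1))
  vanish = A≢B⇒p∣[j+A*[q∸1]]C[j+B*[q∸1]] r pr
    (j≤q∸2⇒j<q (p ^ r) {{m^n≢0 p r {{prime⇒nonZero pr}}}} j≤q∸2)

  -- The bound on n enters here: all multipliers of q - 1 in M are at most n - 1, hence at most j,
  -- so no remainder j - A is truncated.
  n≤1+j : n ≤ suc j
  n≤1+j = subst (n ≤_) (+-comm j 1) n≤j+1

  toℕ≤j : (c : Fin n) → toℕ c ≤ j
  toℕ≤j c = s≤s⁻¹ (≤-trans (toℕ<n c) n≤1+j)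

  n∸index≤j : (c : Fin n) → n ∸ index c ≤ j
  n∸index≤j c = ≤-trans (∸-monoˡ-≤ (index c) n≤1+j) (m∸n≤m j (toℕ c))

  n∸index≢toℕ : n ∸ index a ≢ toℕ b
  n∸index≢toℕ = a+b≢n+1 ∘ n∸[1+a]≡b⇒[1+a]+[1+b]≡n+1 (toℕ<n a)

  open CommutativeRing (𝔽 p) using (_≈_; 0#; 1#; -_; semiring)
  open Exp semiring using () renaming (_^_ to _^𝔽_)

  antidiagonal : M p j n (p ^ r) a b ≈ 0#
  antidiagonal with a ≟ b
  ... | yes refl = y≈0⇒x*y≈0 (𝔽 p) ((- 1#) ^𝔽 (j + 2))
    (p∣m⇒+m≈0 (vanish (n∸index≤j a) (toℕ≤j a) n∸index≢toℕ))
  -- The first binomial vanishes because a ≠ b gives n - a ≠ n - b (indices do not exceed n), the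
  -- second because the entry is off the antidiagonal.
  ... | no a≢b = x≈0∧y≈0⇒-[x+y]≈0 (𝔽 p)
    (p∣m⇒+m≈0 (vanish (n∸index≤j a) (n∸index≤j b)
      (a≢b ∘ toℕ-injective ∘ suc-injective ∘ ∸-cancelˡ-≡ (toℕ<n a) (toℕ<n b))))
    (y≈0⇒x*y≈0 (𝔽 p) ((- 1#) ^𝔽 (j + 1))
      (p∣m⇒+m≈0 (vanish (n∸index≤j a) (toℕ≤j b) n∸index≢toℕ)))
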